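{- Let $n > 3$ be an integer, let $j = 2n-3$, and let $N = n^2 + j = n^2+2n-3$. If $n$ is odd, then the length of the period of the continued fraction of $\sqrt{N}$ is $4$ and $\sqrt{N} = [n, \overline{1, \tfrac{n-3}{2}, 1, 2n}]$. If $n$ is even, then the length of the period is $6$ and $\sqrt{N} = [n, \overline{1, \tfrac{n}{2}-1, 2, \tfrac{n}{2}-1, 1, 2n}]$.
   Context: The (simple) continued fraction expansion of an irrational real number $x$ is the unique infinite sequence $[a_0,a_1,a_2,\dots]$ with $a_0\in\mathbb Z$ and $a_i$ a positive integer for $i\ge 1$, such that the convergents $a_0+\cfrac{1}{a_1+\cfrac{1}{\ddots+\cfrac{1}{a_m}}}$ converge to $x$ as $m\to\infty$. The notation $[a_0,\dots,a_k,\overline{a_{k+1},\dots,a_\ell}]$ means that the block $a_{k+1},\dots,a_\ell$ is repeated infinitely many times after the preperiod $a_0,\dots,a_k$. The length of the period is the number of entries in the shortest repeating block. -}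

module Defs where

open import Data.Nat.Base as ℕ using (ℕ; zero; suc; NonZero)
import Data.Nat.Properties as ℕ
open import Data.Nat.DivMod using (_mod_)
open import Data.Nat.Solver using (module +-*-Solver)
open import Data.Integer.Base as ℤ using (ℤ; +_; -[1+_]; +[1+_])
import Data.Integer.Properties as ℤ
open import Data.Rational.Unnormalised.Base
  using (ℚᵘ; mkℚᵘ; 0ℚᵘ; 1ℚᵘ; _/_; 1/_; _+_; _-_; _*_; _<_; _≤_; *<*; nonNegative)
import Data.Rational.Unnormalised.Properties as ℚ
open import Data.Vec.Base using (Vec; []; _∷_; lookup)
open import Data.Product.Base using (Σ-syntax; ∃-syntax; _×_; _,_; proj₁; proj₂)
open import Data.Sum.Base using (_⊎_; inj₁; inj₂)
open import Function.Base using (_∘_)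
open import Relation.Nullary using (¬_; yes; no; contradiction)
open import Relation.Binary.PropositionalEquality
  using (_≡_; refl; sym; subst₂; cong; _≗_)

-- Real numbers as located Dedekind cuts: lower q means q < x and upper q means
-- x < q.  Both halves respect _≃_, by the closure and openness fields.
record ℝ : Set₁ where
  field
    lower upper     : ℚᵘ → Set
    lower-inhabited : ∃[ q ] lower q
    upper-inhabited : ∃[ q ] upper q
    lower-closed    : ∀ {q r} → q < r → lower r → lower q
    upper-closed    : ∀ {q r} → q < r → upper q → upper r
    lower-open      : ∀ {q} → lower q → ∃[ r ] (q < r × lower r)
    upper-open      : ∀ {r} → upper r → ∃[ q ] (q < r × upper q)
    disjoint        : ∀ {q} → ¬ (lower q × upper q)
    located         : ∀ {q r} → q < r → lower q ⊎ upper r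

module Sqrt (N : ℕ) where

  Below Above : ℚᵘ → Set
  Below q = q < 0ℚᵘ ⊎ q * q < + N / 1
  Above q = 0ℚᵘ < q × + N / 1 < q * q

  private
    sq-mono-≤ : ∀ {q r} → 0ℚᵘ ≤ q → q ≤ r → q * q ≤ r * r
    sq-mono-≤ {q} {r} 0≤q q≤r =
      ℚ.*-mono-≤-nonNeg {q} {r} {q} {r} {{nonNegative 0≤q}} {{nonNegative 0≤q}} q≤r q≤r

    sq-mono-< : ∀ {q r} → 0ℚᵘ ≤ q → q < r → q * q < r * r
    sq-mono-< {q} {r} 0≤q q<r =
      ℚ.*-mono-<-nonNeg {q} {r} {q} {r} {{nonNegative 0≤q}} {{nonNegative 0≤q}} q<r q<r

    frac-< : ∀ {a b d e} → a ℕ.* suc e ℕ.< b ℕ.* suc d → mkℚᵘ (+ a) d < mkℚᵘ (+ b) e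
    frac-< {a} {b} {d} {e} h =
      *<* (subst₂ ℤ._<_ (ℤ.pos-* a (suc e)) (ℤ.pos-* b (suc d)) (ℤ.+<+ h))

    frac-<⁻¹ : ∀ {a b d e} → mkℚᵘ (+ a) d < mkℚᵘ (+ b) e → a ℕ.* suc e ℕ.< b ℕ.* suc d
    frac-<⁻¹ {a} {b} {d} {e} (*<* h) =
      ℤ.drop‿+<+ (subst₂ ℤ._<_ (sym (ℤ.pos-* a (suc e))) (sym (ℤ.pos-* b (suc d))) h)

    sq : ∀ a d → mkℚᵘ (+ a) d * mkℚᵘ (+ a) d ≡ + (a ℕ.* a) / (suc d ℕ.* suc d)
    sq a d = cong (λ z → z / (suc d ℕ.* suc d)) (sym (ℤ.pos-* a a))

    sq<N⇒ : ∀ a d → mkℚᵘ (+ a) d * mkℚᵘ (+ a) d < + N / 1 →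
            a ℕ.* a ℕ.< N ℕ.* (suc d ℕ.* suc d)
    sq<N⇒ a d h rewrite sq a d =
      subst₂ ℕ._<_ (ℕ.*-identityʳ (a ℕ.* a)) refl (frac-<⁻¹ h)

    sq<N⇐ : ∀ a d → a ℕ.* a ℕ.< N ℕ.* (suc d ℕ.* suc d) →
            mkℚᵘ (+ a) d * mkℚᵘ (+ a) d < + N / 1
    sq<N⇐ a d h rewrite sq a d =
      frac-< (subst₂ ℕ._<_ (sym (ℕ.*-identityʳ (a ℕ.* a))) refl h)

    N<sq⇒ : ∀ a d → + N / 1 < mkℚᵘ (+ a) d * mkℚᵘ (+ a) d →
            N ℕ.* (suc d ℕ.* suc d) ℕ.< a ℕ.* a
    N<sq⇒ a d h rewrite sq a d =
      subst₂ ℕ._<_ refl (ℕ.*-identityʳ (a ℕ.* a)) (frac-<⁻¹ h)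

    N<sq⇐ : ∀ a d → N ℕ.* (suc d ℕ.* suc d) ℕ.< a ℕ.* a →
            + N / 1 < mkℚᵘ (+ a) d * mkℚᵘ (+ a) d
    N<sq⇐ a d h rewrite sq a d =
      frac-< (subst₂ ℕ._<_ refl (sym (ℕ.*-identityʳ (a ℕ.* a))) h)

    -- The fraction a/b is moved strictly towards √N by replacing it with
    -- (c a + N b)/(a + c b), where c = N + 1: for r the new fraction,
    -- r² - N = (c² - N)(a² - N b²)/(a + c b)².
    num den : ℕ → ℕ → ℕ
    num a b = suc N ℕ.* a ℕ.+ N ℕ.* b
    den a b = b ℕ.+ (a ℕ.+ N ℕ.* b)

    common : ℕ → ℕ → ℕ
    common a b = 2 ℕ.* suc N ℕ.* N ℕ.* a ℕ.* b ℕ.+ N ℕ.* (a ℕ.* a) ℕ.+ N ℕ.* (N ℕ.* (b ℕ.* b))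

    num² : ∀ a b M → (suc M ℕ.* a ℕ.+ M ℕ.* b) ℕ.* (suc M ℕ.* a ℕ.+ M ℕ.* b) ≡
      (2 ℕ.* suc M ℕ.* M ℕ.* a ℕ.* b ℕ.+ M ℕ.* (a ℕ.* a) ℕ.+ M ℕ.* (M ℕ.* (b ℕ.* b)))
      ℕ.+ suc (M ℕ.* M ℕ.+ M) ℕ.* (a ℕ.* a)
    num² = solve 3 (λ a b M →
      ((con 1 :+ M) :* a :+ M :* b) :* ((con 1 :+ M) :* a :+ M :* b) :=
      (con 2 :* (con 1 :+ M) :* M :* a :* b :+ M :* (a :* a) :+ M :* (M :* (b :* b)))
      :+ (con 1 :+ (M :* M :+ M)) :* (a :* a)) refl
      where open +-*-Solver

    N*den² : ∀ a b M → M ℕ.* ((b ℕ.+ (a ℕ.+ M ℕ.* b)) ℕ.* (b ℕ.+ (a ℕ.+ M ℕ.* b))) ≡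
      (2 ℕ.* suc M ℕ.* M ℕ.* a ℕ.* b ℕ.+ M ℕ.* (a ℕ.* a) ℕ.+ M ℕ.* (M ℕ.* (b ℕ.* b)))
      ℕ.+ suc (M ℕ.* M ℕ.+ M) ℕ.* (M ℕ.* (b ℕ.* b))
    N*den² = solve 3 (λ a b M →
      M :* ((b :+ (a :+ M :* b)) :* (b :+ (a :+ M :* b))) :=
      (con 2 :* (con 1 :+ M) :* M :* a :* b :+ M :* (a :* a) :+ M :* (M :* (b :* b)))
      :+ (con 1 :+ (M :* M :+ M)) :* (M :* (b :* b))) refl
      where open +-*-Solver

    a*den : ∀ a b M → a ℕ.* (b ℕ.+ (a ℕ.+ M ℕ.* b)) ≡ suc M ℕ.* a ℕ.* b ℕ.+ a ℕ.* a
    a*den = solve 3 (λ a b M →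
      a :* (b :+ (a :+ M :* b)) := (con 1 :+ M) :* a :* b :+ a :* a) refl
      where open +-*-Solver

    num*b : ∀ a b M → (suc M ℕ.* a ℕ.+ M ℕ.* b) ℕ.* b ≡ suc M ℕ.* a ℕ.* b ℕ.+ M ℕ.* (b ℕ.* b)
    num*b = solve 3 (λ a b M →
      ((con 1 :+ M) :* a :+ M :* b) :* b := (con 1 :+ M) :* a :* b :+ M :* (b :* b)) refl
      where open +-*-Solver

    below-num-den : ∀ a b → a ℕ.* a ℕ.< N ℕ.* (b ℕ.* b) →
      a ℕ.* den a b ℕ.< num a b ℕ.* b ×
      num a b ℕ.* num a b ℕ.< N ℕ.* (den a b ℕ.* den a b)
    below-num-den a b h =
      subst₂ ℕ._<_ (sym (a*den a b N)) (sym (num*b a b N))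
        (ℕ.+-monoʳ-< (suc N ℕ.* a ℕ.* b) h) ,
      subst₂ ℕ._<_ (sym (num² a b N)) (sym (N*den² a b N))
        (ℕ.+-monoʳ-< (common a b) (ℕ.*-monoʳ-< (suc (N ℕ.* N ℕ.+ N)) h))

    above-num-den : ∀ a b → N ℕ.* (b ℕ.* b) ℕ.< a ℕ.* a →
      num a b ℕ.* b ℕ.< a ℕ.* den a b ×
      N ℕ.* (den a b ℕ.* den a b) ℕ.< num a b ℕ.* num a b
    above-num-den a b h =
      subst₂ ℕ._<_ (sym (num*b a b N)) (sym (a*den a b N))
        (ℕ.+-monoʳ-< (suc N ℕ.* a ℕ.* b) h) ,
      subst₂ ℕ._<_ (sym (N*den² a b N)) (sym (num² a b N))
        (ℕ.+-monoʳ-< (common a b) (ℕ.*-monoʳ-< (suc (N ℕ.* N ℕ.+ N)) h))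

    closer : ℕ → ℕ → ℚᵘ
    closer a d = mkℚᵘ (+ num a (suc d)) (d ℕ.+ (a ℕ.+ N ℕ.* suc d))

    below-closer : ∀ a d → a ℕ.* a ℕ.< N ℕ.* (suc d ℕ.* suc d) →
      mkℚᵘ (+ a) d < closer a d × closer a d * closer a d < + N / 1
    below-closer a d h =
      frac-< (proj₁ (below-num-den a (suc d) h)) ,
      sq<N⇐ (num a (suc d)) (d ℕ.+ (a ℕ.+ N ℕ.* suc d)) (proj₂ (below-num-den a (suc d) h))

    above-closer : ∀ a d → N ℕ.* (suc d ℕ.* suc d) ℕ.< a ℕ.* a →
      closer a d < mkℚᵘ (+ a) d × + N / 1 < closer a d * closer a d
    above-closer a d h =
      frac-< (proj₁ (above-num-den a (suc d) h)) ,
      N<sq⇐ (num a (suc d)) (d ℕ.+ (a ℕ.+ N ℕ.* suc d)) (proj₂ (above-num-den a (suc d) h))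

    negative-open : ∀ {q} → q < 0ℚᵘ → ∃[ r ] (q < r × Below r)
    negative-open q<0 with r , q<r , r<0 ← ℚ.<-dense q<0 = r , q<r , inj₁ r<0

    below-open : ∀ {q} → Below q → ∃[ r ] (q < r × Below r)
    below-open (inj₁ q<0) = negative-open q<0
    below-open {mkℚᵘ -[1+ n ] d} (inj₂ _) = negative-open (ℚ.negative⁻¹ (mkℚᵘ -[1+ n ] d))
    below-open {mkℚᵘ (+ a) d} (inj₂ h) =
      closer a d , proj₁ moved , inj₂ (proj₂ moved)
      where moved = below-closer a d (sq<N⇒ a d h)

    above-open : ∀ {r} → Above r → ∃[ q ] (q < r × Above q)
    above-open {mkℚᵘ (+ zero) d} (0<r , _) =
      contradiction 0<r (ℚ.<-irrefl (ℚ.≃-sym (ℚ.↥p≡0⇒p≃0 (mkℚᵘ (+ zero) d) refl)))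
    above-open {mkℚᵘ +[1+ a ] d} (_ , h) =
      closer (suc a) d , proj₁ moved , ℚ.positive⁻¹ (closer (suc a) d) , proj₂ moved
      where moved = above-closer (suc a) d (N<sq⇒ (suc a) d h)
    above-open {mkℚᵘ -[1+ a ] d} (0<r , _) =
      contradiction 0<r (ℚ.<-asym (ℚ.negative⁻¹ (mkℚᵘ -[1+ a ] d)))

    below-closed : ∀ {q r} → q < r → Below r → Below q
    below-closed q<r (inj₁ r<0) = inj₁ (ℚ.<-trans q<r r<0)
    below-closed {q} q<r (inj₂ r²<N) with q ℚ.<? 0ℚᵘ
    ... | yes q<0 = inj₁ q<0
    ... | no  q≮0 = inj₂ (ℚ.<-trans (sq-mono-< (ℚ.≮⇒≥ q≮0) q<r) r²<N)

    above-closed : ∀ {q r} → q < r → Above q → Above r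
    above-closed q<r (0<q , N<q²) =
      ℚ.<-trans 0<q q<r , ℚ.<-trans N<q² (sq-mono-< (ℚ.<⇒≤ 0<q) q<r)

    below-above-disjoint : ∀ {q} → ¬ (Below q × Above q)
    below-above-disjoint (inj₁ q<0  , 0<q , _)   = ℚ.<-asym q<0 0<q
    below-above-disjoint (inj₂ q²<N , _ , N<q²) = ℚ.<-asym q²<N N<q²

    below-above-located : ∀ {q r} → q < r → Below q ⊎ Above r
    below-above-located {q} q<r with q ℚ.<? 0ℚᵘ | q * q ℚ.<? + N / 1
    ... | yes q<0 | _        = inj₁ (inj₁ q<0)
    ... | no  _   | yes q²<N = inj₁ (inj₂ q²<N)
    ... | no  q≮0 | no  q²≮N =
      inj₂ (ℚ.≤-<-trans (ℚ.≮⇒≥ q≮0) q<r ,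
            ℚ.≤-<-trans (ℚ.≮⇒≥ q²≮N) (sq-mono-< (ℚ.≮⇒≥ q≮0) q<r))

    N+1-above : Above (+ suc N / 1)
    N+1-above = ℚ.positive⁻¹ (+ suc N / 1) ,
      N<sq⇐ (suc N) 0 (subst₂ ℕ._≤_ (cong suc (sym (ℕ.*-identityʳ N))) refl (ℕ.m≤m*n (suc N) (suc N)))

  √N : ℝ
  √N = record
    { lower           = Below
    ; upper           = Above
    ; lower-inhabited = mkℚᵘ -[1+ 0 ] 0 , inj₁ (ℚ.negative⁻¹ (mkℚᵘ -[1+ 0 ] 0))
    ; upper-inhabited = + suc N / 1 , N+1-above
    ; lower-closed    = below-closed
    ; upper-closed    = above-closed
    ; lower-open      = below-open
    ; upper-open      = above-open
    ; disjoint        = below-above-disjoint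
    ; located         = below-above-located
    }

√ : ℕ → ℝ
√ N = Sqrt.√N N

-- c - ε < x < c + ε
∣_-_∣<_ : ℚᵘ → ℝ → ℚᵘ → Set
∣ c - x ∣< ε = ℝ.lower x (c - ε) × ℝ.upper x (c + ε)

_⟶_ : (ℕ → ℚᵘ) → ℝ → Set
s ⟶ x = ∀ ε → 0ℚᵘ < ε → ∃[ M ] (∀ m → M ℕ.≤ m → ∣ s m - x ∣< ε)

-- Total reciprocal; the junk value at 0 is never reached by the convergents of
-- a sequence whose entries after the first are positive.
recip : ℚᵘ → ℚᵘ
recip   (mkℚᵘ (+ zero)  _) = 0ℚᵘ
recip q@(mkℚᵘ +[1+ _ ] _) = 1/ q
recip q@(mkℚᵘ -[1+ _ ] _) = 1/ q

convergent : (ℕ → ℤ) → ℕ → ℚᵘ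
convergent a zero    = a 0 / 1
convergent a (suc m) = a 0 / 1 + recip (convergent (a ∘ suc) m)

IsContinuedFractionOf : (ℕ → ℤ) → ℝ → Set
IsContinuedFractionOf a x = (∀ i → ℤ.Positive (a (suc i))) × (convergent a ⟶ x)

[_,overline_] : ∀ {k p} .{{_ : NonZero p}} → Vec ℤ k → Vec ℤ p → ℕ → ℤ
[_,overline_] {p = p} []        block i       = lookup block (i mod p)
[_,overline_]         (x ∷ pre) block zero    = x
[_,overline_]         (x ∷ pre) block (suc i) = [ pre ,overline block ] i

HasRepeatingBlock : (ℕ → ℤ) → ℕ → Set
HasRepeatingBlock a p =
  Σ[ p≢0 ∈ NonZero p ] ∃[ k ] Σ[ pre ∈ Vec ℤ (suc k) ] Σ[ block ∈ Vec ℤ p ]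
    a ≗ [_,overline_] {{p≢0}} pre block

IsPeriodLength : (ℕ → ℤ) → ℕ → Set
IsPeriodLength a p = HasRepeatingBlock a p × (∀ q → HasRepeatingBlock a q → p ℕ.≤ q)

{-# OPTIONS --safe #-}

-- Write the complete quotients of √N as (√N + P i) / Q i.  The binary forms
-- Q i p² - 2 P i p q - Q (i - 1) q² are carried into each other, up to sign, by
-- (p , q) ↦ (a i p + q , p), so a convergent p / q of √N, taken from its first m
-- entries, satisfies |p² - N q²| = Q m.  When P and Q are periodic this is
-- bounded, while p grows without bound, so the convergents tend to √N.  The
-- period cannot be shorter than the block because 2n occurs only once in it.
module Submission where

open import Defs
open import Data.Nat
open import Data.Nat.Properties
open import Data.Nat.DivMod
open import Data.Nat.Divisibility using (_∣_; _∤_; divides; ∣⇒≤; ∣m+n∣m⇒∣n; m%n≡0⇒n∣m)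
open import Data.Nat.Tactic.RingSolver using (solve-∀)
open import Data.Integer as ℤ using (ℤ; +_; +[1+_]; -[1+_]; _⊖_)
import Data.Integer.Properties as ℤ
open import Data.Rational.Unnormalised as ℚ using (mkℚᵘ; *<*; 0ℚᵘ)
open import Data.Fin using (Fin; toℕ)
open import Data.Fin.Properties using (toℕ-injective; toℕ-fromℕ<; toℕ<n)
open import Data.Fin.Patterns
open import Data.Vec using (Vec; []; _∷_; lookup; map; sum)
open import Data.Vec.Properties using (lookup-map)
open import Data.Product using (_×_; _,_; ∃-syntax)
open import Data.Sum using (inj₁; inj₂)
open import Function using (_∘_)
open import Relation.Nullary using (yes; no; contradiction)
open import Relation.Binary.PropositionalEquality

-- Convergents as quotients of continuants.

-- For the first m entries of a; convergent a m uses the first suc m of them.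
numerator denominator : (ℕ → ℕ) → ℕ → ℕ
numerator a zero = 1
numerator a (suc m) = a 0 * numerator (a ∘ suc) m + denominator (a ∘ suc) m
denominator a zero = 0
denominator a (suc m) = numerator (a ∘ suc) m

numerator≢0 : ∀ {a} → (∀ i → NonZero (a i)) → ∀ m → NonZero (numerator a m)
numerator≢0 a≢0 zero = _
numerator≢0 {a} a≢0 (suc m) = >-nonZero (<-≤-trans
  (>-nonZero⁻¹ _ {{m*n≢0 (a 0) _ {{a≢0 0}} {{numerator≢0 (a≢0 ∘ suc) m}}}}) (m≤m+n _ _))

-- Each further entry adds a nonzero numerator of the twice shifted sequence. This linear growth is
-- all that is needed to outrun a fixed bound.
m<numerator : ∀ {a} → (∀ i → NonZero (a i)) → ∀ m → m < numerator a (suc m)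
m<numerator {a} a≢0 zero = >-nonZero⁻¹ _ {{numerator≢0 {a} a≢0 1}}
m<numerator {a} a≢0 (suc m) = begin-strict
  suc m                                                   <⟨ s<s (m<numerator (a≢0 ∘ suc) m) ⟩
  1 + numerator (a ∘ suc) (suc m)                         ≡⟨ +-comm 1 _ ⟩
  numerator (a ∘ suc) (suc m) + 1
    ≤⟨ +-mono-≤ (m≤n*m _ (a 0) {{a≢0 0}})
                (>-nonZero⁻¹ _ {{numerator≢0 (a≢0 ∘ suc ∘ suc) m}}) ⟩
  a 0 * numerator (a ∘ suc) (suc m) + numerator (a ∘ suc ∘ suc) m ∎
  where open ≤-Reasoning

+-recip : ∀ a p q .{{_ : NonZero p}} .{{_ : NonZero q}} →
  + a ℚ./ 1 ℚ.+ recip (+ p ℚ./ q) ≡ + (a * p + q) ℚ./ p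
+-recip a (suc p) (suc q) = cong₂ mkℚᵘ
  (cong₂ ℤ._+_ (sym (ℤ.pos-* a (suc p))) (ℤ.*-identityʳ (+ suc q))) (+-identityʳ p)

-- This holds with `≡`, not merely `≃`: adding `a / 1` to `q / p` without normalising yields exactly
-- `(a * p + q) / p`. Positive entries keep `recip` away from its value at 0.
convergent-fraction : ∀ {a : ℕ → ℤ} {b} → (∀ i → a i ≡ + b i) → (b≢0 : ∀ i → NonZero (b i)) →
  ∀ m → convergent a m ≡
        ℚ._/_ (+ numerator b (suc m)) (denominator b (suc m)) {{numerator≢0 (b≢0 ∘ suc) m}}
convergent-fraction {b = b} a≡b b≢0 zero = cong (ℚ._/ 1)
  (trans (a≡b 0) (cong +_ (trans (sym (*-identityʳ (b 0))) (sym (+-identityʳ _)))))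
convergent-fraction {a} {b} a≡b b≢0 (suc m) =
  trans (cong₂ (λ x y → x ℚ./ 1 ℚ.+ recip y) (a≡b 0) (convergent-fraction (a≡b ∘ suc) (b≢0 ∘ suc) m))
        (+-recip (b 0) _ _ {{numerator≢0 (b≢0 ∘ suc) (suc m)}} {{numerator≢0 (b≢0 ∘ suc ∘ suc) m}})

-- The binary forms and their recurrence.

-- Read as k - m = n - l. It turns the sign change of the forms into an equation between natural
-- numbers.
sum≡⇒∣-∣≡ : ∀ {k l m n} → k + l ≡ m + n → ∣ k - m ∣ ≡ ∣ l - n ∣
sum≡⇒∣-∣≡ {k} {l} {m} {n} eq = begin
  ∣ k - m ∣           ≡⟨ ∣m+n-m+o∣≡∣n-o∣ l k m ⟨
  ∣ l + k - l + m ∣   ≡⟨ cong₂ ∣_-_∣ (trans (+-comm l k) eq) (+-comm l m) ⟩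
  ∣ m + n - m + l ∣   ≡⟨ ∣m+n-m+o∣≡∣n-o∣ m n l ⟩
  ∣ n - l ∣           ≡⟨ ∣-∣-comm n l ⟩
  ∣ l - n ∣           ∎
  where open ≡-Reasoning

∣form∣ : (P Q₋ Q p q : ℕ) → ℕ
∣form∣ P Q₋ Q p q = ∣ Q * (p * p) - (2 * P * (p * q) + Q₋ * (q * q)) ∣

-- The hypotheses are the recurrences P′ = a Q - P and Q₊ = Q₋ + a (P - P′) with the negative terms
-- moved across.
∣form∣-step : ∀ {a P P′ Q₋ Q Q₊} x y → P′ + P ≡ a * Q → Q₊ + a * P′ ≡ Q₋ + a * P →
  ∣form∣ P Q₋ Q (a * x + y) x ≡ ∣form∣ P′ Q Q₊ x y
∣form∣-step {a} {P} {P′} {Q₋} {Q} {Q₊} x y P-eq Q-eq =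
  -- The term `a * P′ * (x * x)` is added to both sides to complete `Q₊ + a * P′`, which `Q-eq` can
  -- rewrite.
  sum≡⇒∣-∣≡ {k} {l} {m} {n} (+-cancelʳ-≡ (a * P′ * (x * x)) _ _ (begin
    k + l + a * P′ * (x * x)
      ≡⟨ expandˡ a P′ Q Q₊ x y ⟩
    a * Q * (a * (x * x) + 2 * (x * y)) + Q * (y * y) + (Q₊ + a * P′) * (x * x)
      ≡⟨ cong₂ (λ u v → u * (a * (x * x) + 2 * (x * y)) + Q * (y * y) + v * (x * x)) (sym P-eq) Q-eq ⟩
    (P′ + P) * (a * (x * x) + 2 * (x * y)) + Q * (y * y) + (Q₋ + a * P) * (x * x)
      ≡⟨ expandʳ a P P′ Q₋ Q x y ⟩
    m + n + a * P′ * (x * x) ∎))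
  where
  open ≡-Reasoning
  k l m n : ℕ
  k = Q * ((a * x + y) * (a * x + y))
  l = Q₊ * (x * x)
  m = 2 * P * ((a * x + y) * x) + Q₋ * (x * x)
  n = 2 * P′ * (x * y) + Q * (y * y)
  expandˡ : ∀ a P′ Q Q₊ x y →
    Q * ((a * x + y) * (a * x + y)) + Q₊ * (x * x) + a * P′ * (x * x) ≡
    a * Q * (a * (x * x) + 2 * (x * y)) + Q * (y * y) + (Q₊ + a * P′) * (x * x)
  expandˡ = solve-∀
  expandʳ : ∀ a P P′ Q₋ Q x y →
    (P′ + P) * (a * (x * x) + 2 * (x * y)) + Q * (y * y) + (Q₋ + a * P) * (x * x) ≡
    (2 * P * ((a * x + y) * x) + Q₋ * (x * x)) + (2 * P′ * (x * y) + Q * (y * y)) + a * P′ * (x * x)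
  expandʳ = solve-∀

-- Here Q is shifted by one: Q (suc i) is the denominator of the i-th complete
-- quotient, and Q 0 stands for Q (-1) = N.
∣form∣-convergent : (a P Q : ℕ → ℕ) →
  (∀ i → P (suc i) + P i ≡ a i * Q (suc i)) →
  (∀ i → Q (2 + i) + a i * P (suc i) ≡ Q i + a i * P i) →
  ∀ m → ∣form∣ (P 0) (Q 0) (Q 1) (numerator a m) (denominator a m) ≡ Q (suc m)
∣form∣-convergent a P Q P-step Q-step zero = begin
  ∣ Q 1 * 1 - (2 * P 0 * 0 + Q 0 * 0) ∣
    ≡⟨ cong₂ ∣_-_∣ (*-identityʳ (Q 1)) (cong₂ _+_ (*-zeroʳ (2 * P 0)) (*-zeroʳ (Q 0))) ⟩
  ∣ Q 1 - 0 ∣ ≡⟨ ∣-∣-identityʳ (Q 1) ⟩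
  Q 1 ∎
  where open ≡-Reasoning
∣form∣-convergent a P Q P-step Q-step (suc m) = trans
  (∣form∣-step {a 0} {P 0} {P 1} {Q 0} {Q 1} {Q 2} (numerator (a ∘ suc) m) _ (P-step 0) (Q-step 0))
  (∣form∣-convergent (a ∘ suc) (P ∘ suc) (Q ∘ suc) (P-step ∘ suc) (Q-step ∘ suc) m)

-- From a small value of p² - N q² to closeness to √N.

positive-frac : ∀ a d .{{_ : NonZero a}} → 0ℚᵘ ℚ.< mkℚᵘ (+ a) d
positive-frac (suc a) d = *<* (ℤ.+<+ z<s)

negative-frac : ∀ a d .{{_ : NonZero a}} → mkℚᵘ (ℤ.- + a) d ℚ.< 0ℚᵘ
negative-frac (suc a) d = *<* ℤ.-<+

square<-ℚ : ∀ {N} a d → a * a < N * (suc d * suc d) →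
  mkℚᵘ (+ a) d ℚ.* mkℚᵘ (+ a) d ℚ.< + N ℚ./ 1
square<-ℚ {N} a d a²<Nd² = *<* (subst₂ ℤ._<_
  (trans (ℤ.pos-* a a) (sym (ℤ.*-identityʳ (+ a ℤ.* + a)))) (ℤ.pos-* N _) (ℤ.+<+ a²<Nd²))

<square-ℚ : ∀ {N} a d → N * (suc d * suc d) < a * a →
  + N ℚ./ 1 ℚ.< mkℚᵘ (+ a) d ℚ.* mkℚᵘ (+ a) d
<square-ℚ {N} a d Nd²<a² = *<* (subst₂ ℤ._<_
  (ℤ.pos-* N _) (trans (ℤ.pos-* a a) (sym (ℤ.*-identityʳ (+ a ℤ.* + a)))) (ℤ.+<+ Nd²<a²))

-- Going from x to x + t raises the square by at least t x ≥ x, more than the error.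
near-square⇒<[x+t]² : ∀ {x t D} → 1 ≤ t → ∣ x * x - D ∣ < x → D < (x + t) * (x + t)
near-square⇒<[x+t]² {x} {t} {D} 1≤t close = begin-strict
  D                          ≤⟨ m≤n+∣n-m∣ D (x * x) ⟩
  x * x + ∣ x * x - D ∣      <⟨ +-monoʳ-< (x * x) close ⟩
  x * x + x                  ≤⟨ +-mono-≤ (*-monoʳ-≤ x (m≤m+n x t)) (m≤n*m x t {{>-nonZero 1≤t}}) ⟩
  x * (x + t) + t * x        ≤⟨ +-monoʳ-≤ _ (*-monoʳ-≤ t (m≤m+n x t)) ⟩
  x * (x + t) + t * (x + t)  ≡⟨ *-distribʳ-+ (x + t) x t ⟨
  (x + t) * (x + t)          ∎
  where open ≤-Reasoning

-- Here x = u + t, which avoids truncated subtraction; the square drops by at least t (u + t) ≥ u +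
-- t.
near-square⇒u²< : ∀ {u t D} → 1 ≤ t → ∣ (u + t) * (u + t) - D ∣ < u + t → u * u < D
near-square⇒u²< {u} {t} {D} 1≤t close = +-cancelʳ-< (u + t) (u * u) D (begin-strict
  u * u + (u + t)
    ≤⟨ +-monoʳ-≤ (u * u) (m≤n*m (u + t) t {{>-nonZero 1≤t}}) ⟩
  u * u + t * (u + t)
    ≤⟨ +-monoˡ-≤ (t * (u + t)) (*-monoʳ-≤ u (m≤m+n u t)) ⟩
  u * (u + t) + t * (u + t)             ≡⟨ *-distribʳ-+ (u + t) u t ⟨
  (u + t) * (u + t)                     ≤⟨ m≤n+∣m-n∣ _ D ⟩
  D + ∣ (u + t) * (u + t) - D ∣         <⟨ +-monoʳ-< D close ⟩
  D + (u + t)                           ∎)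
  where open ≤-Reasoning

-- Scaling multiplies the error by F² but p only by F, hence the factor `F` in the hypothesis.
near-square-scale : ∀ N p q F .{{_ : NonZero F}} → ∣ p * p - N * (q * q) ∣ * F < p →
  ∣ p * F * (p * F) - N * (q * F * (q * F)) ∣ < p * F
near-square-scale N p q F close = begin-strict
  ∣ p * F * (p * F) - N * (q * F * (q * F)) ∣
    ≡⟨ cong₂ ∣_-_∣ (pp p F) (nqq N q F) ⟩
  ∣ p * p * (F * F) - N * (q * q) * (F * F) ∣
    ≡⟨ *-distribʳ-∣-∣ (F * F) (p * p) (N * (q * q)) ⟨
  ∣ p * p - N * (q * q) ∣ * (F * F)
    ≡⟨ *-assoc ∣ p * p - N * (q * q) ∣ F F ⟨
  ∣ p * p - N * (q * q) ∣ * F * F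
    <⟨ *-monoˡ-< F close ⟩
  p * F ∎
  where
  open ≤-Reasoning
  pp : ∀ p F → p * F * (p * F) ≡ p * p * (F * F)
  pp = solve-∀
  nqq : ∀ N q F → N * (q * F * (q * F)) ≡ N * (q * q) * (F * F)
  nqq = solve-∀

-- Only a large p is needed: multiplying the condition by suc f gives
-- |x² - D| < x, which a shift of x by t ≥ 1 outweighs.
fraction-near-√ : ∀ N p d e f → ∣ p * p - N * (suc d * suc d) ∣ * suc f < p →
  ∣ mkℚᵘ (+ p) d - √ N ∣< mkℚᵘ +[1+ e ] f
fraction-near-√ N p d e f close = below , above
  where
  x t D : ℕ
  x = p * suc f
  t = suc e * suc d
  D = N * (suc d * suc f * (suc d * suc f))

  near : ∣ x * x - D ∣ < x
  near = near-square-scale N p (suc d) (suc f) close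

  sum-eq : mkℚᵘ (+ p) d ℚ.+ mkℚᵘ +[1+ e ] f ≡ + (x + t) ℚ./ (suc d * suc f)
  sum-eq = cong (λ z → z ℚ./ (suc d * suc f))
    (cong₂ ℤ._+_ (sym (ℤ.pos-* p (suc f))) (sym (ℤ.pos-* (suc e) (suc d))))

  diff-eq : mkℚᵘ (+ p) d ℚ.- mkℚᵘ +[1+ e ] f ≡ (x ⊖ t) ℚ./ (suc d * suc f)
  diff-eq = cong (λ z → z ℚ./ (suc d * suc f))
    (trans (cong (ℤ._+ (-[1+ e ] ℤ.* + suc d)) (sym (ℤ.pos-* p (suc f)))) (ℤ.m-n≡m⊖n x t))

  above : ℝ.upper (√ N) (mkℚᵘ (+ p) d ℚ.+ mkℚᵘ +[1+ e ] f)
  above = subst (ℝ.upper (√ N)) (sym sum-eq)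
    (positive-frac (x + t) _ {{>-nonZero (<-≤-trans z<s (m≤n+m t x))}} ,
     <square-ℚ (x + t) (f + d * suc f) (near-square⇒<[x+t]² z<s near))

  below-⊖ : ℝ.lower (√ N) ((x ⊖ t) ℚ./ (suc d * suc f))
  -- If ε exceeds the fraction, the difference is negative and so below √N by the first alternative
  -- of `Below`. Otherwise `x ∸ t` is exact.
  below-⊖ with x <? t
  ... | yes x<t = subst (λ z → ℝ.lower (√ N) (z ℚ./ (suc d * suc f))) (sym (ℤ.⊖-< x<t))
    (inj₁ (negative-frac (t ∸ x) _ {{>-nonZero (m<n⇒0<n∸m x<t)}}))
  ... | no x≮t = subst (λ z → ℝ.lower (√ N) (z ℚ./ (suc d * suc f))) (sym (ℤ.⊖-≥ (≮⇒≥ x≮t)))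
    (inj₂ (square<-ℚ (x ∸ t) (f + d * suc f) (near-square⇒u²< {t = t} z<s
      (subst (λ z → ∣ z * z - D ∣ < z) (sym (m∸n+n≡m (≮⇒≥ x≮t))) near))))

  below : ℝ.lower (√ N) (mkℚᵘ (+ p) d ℚ.- mkℚᵘ +[1+ e ] f)
  below = subst (ℝ.lower (√ N)) (sym diff-eq) below-⊖

-- Periodicity enters through the bound `B` alone. The initial values make the starting form p² - N
-- q².
periodic-√-converges : ∀ N {a : ℕ → ℤ} {b : ℕ → ℕ} (P Q : ℕ → ℕ) {B} →
  (∀ i → a i ≡ + b i) → (∀ i → NonZero (b i)) →
  P 0 ≡ 0 → Q 0 ≡ N → Q 1 ≡ 1 →
  (∀ i → P (suc i) + P i ≡ b i * Q (suc i)) →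
  (∀ i → Q (2 + i) + b i * P (suc i) ≡ Q i + b i * P i) →
  (∀ i → Q i ≤ B) → convergent a ⟶ √ N
periodic-√-converges N {a} {b} P Q {B} a≡b b≢0 P₀ Q₀ Q₁ P-step Q-step Q≤B = converge
  where
  close : ∀ m → let p = numerator b m; q = denominator b m in ∣ p * p - N * (q * q) ∣ ≤ B
  close m = begin
    ∣ p * p - N * (q * q) ∣
      ≡⟨ cong (λ z → ∣ z - N * (q * q) ∣) (*-identityˡ (p * p)) ⟨
    ∣form∣ 0 N 1 p q
      ≡⟨ cong₂ (λ u (v , w) → ∣form∣ v w u p q) Q₁ (cong₂ _,_ P₀ Q₀) ⟨
    ∣form∣ (P 0) (Q 0) (Q 1) p q
      ≡⟨ ∣form∣-convergent b P Q P-step Q-step m ⟩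
    Q (suc m) ≤⟨ Q≤B (suc m) ⟩
    B ∎
    where
    open ≤-Reasoning
    p q : ℕ
    p = numerator b m
    q = denominator b m

  converge : convergent a ⟶ √ N
  converge (mkℚᵘ (+ zero) f) (*<* (ℤ.+<+ ()))
  converge (mkℚᵘ -[1+ e ] f) (*<* ())
  -- The threshold comes from `fraction-near-√`: the error is at most `B`, and p > m ≥ `B * suc f`.
  converge (mkℚᵘ +[1+ e ] f) _ = B * suc f , λ m B*F≤m →
    subst (λ c → ∣ c - √ N ∣< mkℚᵘ +[1+ e ] f) (sym (convergent-fraction a≡b b≢0 m))
      (near m (denominator b (suc m)) {{numerator≢0 (b≢0 ∘ suc) m}} refl B*F≤m)
    where
    -- The denominator is generalised to `q` so that it can be matched with `suc d`.
    near : ∀ m q .{{_ : NonZero q}} → q ≡ denominator b (suc m) → B * suc f ≤ m →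
      ∣ + numerator b (suc m) ℚ./ q - √ N ∣< mkℚᵘ +[1+ e ] f
    near m (suc d) eq B*F≤m = fraction-near-√ N p d e f (begin-strict
      ∣ p * p - N * (suc d * suc d) ∣ * suc f
        ≤⟨ *-monoˡ-≤ (suc f) (subst (λ q → ∣ p * p - N * (q * q) ∣ ≤ B) (sym eq) (close (suc m))) ⟩
      B * suc f ≤⟨ B*F≤m ⟩
      m         <⟨ m<numerator b≢0 m ⟩
      p         ∎)
      where
      open ≤-Reasoning
      p : ℕ
      p = numerator b (suc m)

-- Periodic sequences and cyclic indices.

-- The cyclic successor reduces a recurrence along a periodic sequence to `p` checks.
next : ∀ {p} .{{_ : NonZero p}} → Fin p → Fin p
next {p} k = suc (toℕ k) mod p

toℕ-mod : ∀ i p .{{_ : NonZero p}} → toℕ (i mod p) ≡ i % p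
toℕ-mod i p = toℕ-fromℕ< (m%n<n i p)

mod-cong : ∀ {i j} p .{{_ : NonZero p}} → i % p ≡ j % p → i mod p ≡ j mod p
mod-cong {i} {j} p eq = toℕ-injective (trans (toℕ-mod i p) (trans eq (sym (toℕ-mod j p))))

suc-mod : ∀ i p .{{_ : NonZero p}} → suc i mod p ≡ next (i mod p)
suc-mod i p = mod-cong p (begin
  suc i % p                    ≡⟨ %-distribˡ-+ 1 i p ⟩
  (1 % p + i % p) % p          ≡⟨ cong (λ z → (1 % p + z) % p) (m%n%n≡m%n i p) ⟨
  (1 % p + i % p % p) % p      ≡⟨ %-distribˡ-+ 1 (i % p) p ⟨
  suc (i % p) % p              ≡⟨ cong (λ z → suc z % p) (toℕ-mod i p) ⟨
  suc (toℕ (i mod p)) % p      ∎)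
  where open ≡-Reasoning

infixr 5 _∷ᵖ_

-- The partial quotients, `P` and `Q` each have one exceptional first entry, `n`, `0` and `N`,
-- before a purely periodic tail.
_∷ᵖ_ : ∀ {p} .{{_ : NonZero p}} → ℕ → Vec ℕ p → ℕ → ℕ
(x ∷ᵖ block) zero = x
_∷ᵖ_ {p} x block (suc i) = lookup block (i mod p)

overline-map : ∀ {p} .{{_ : NonZero p}} x (block : Vec ℕ p) i →
  [ + x ∷ [] ,overline map +_ block ] i ≡ + (x ∷ᵖ block) i
overline-map x block zero = refl
overline-map {p} x block (suc i) = lookup-map (i mod p) +_ block

lookup≤sum : ∀ {n} (xs : Vec ℕ n) k → lookup xs k ≤ sum xs
lookup≤sum (x ∷ xs) 0F           = m≤m+n x (sum xs)
lookup≤sum (x ∷ xs) (Fin.suc k)  = ≤-trans (lookup≤sum xs k) (m≤n+m (sum xs) x)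

-- The vectors list P 1 , … , P p and Q 0 , … , Q (p - 1).
periodic-√ : ∀ {p} .{{p≢0 : NonZero p}} N n (a P Q : Vec ℕ p) .{{_ : NonZero n}} →
  (∀ k → NonZero (lookup a k)) →
  lookup Q (0 mod p) ≡ 1 → lookup P (0 mod p) ≡ n →
  lookup Q (1 mod p) + n * n ≡ N →
  (∀ k → lookup P (next k) + lookup P k ≡ lookup a k * lookup Q (next k)) →
  (∀ k → lookup Q (next (next k)) + lookup a k * lookup P (next k) ≡
         lookup Q k + lookup a k * lookup P k) →
  IsContinuedFractionOf [ + n ∷ [] ,overline map +_ a ] (√ N)
periodic-√ {p} {{p≢0}} N n a P Q {{n≢0}} a≢0 Q₀ P₁ Q₁ P-step Q-step = positive ,
  periodic-√-converges N {b = n ∷ᵖ a} (0 ∷ᵖ P) (N ∷ᵖ Q) {N + sum Q}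
    (overline-map n a) nonzero refl refl Q₀ P-eq Q-eq bound
  where
  nonzero : ∀ i → NonZero ((n ∷ᵖ a) i)
  -- The instance for `n` is irrelevant, so a relevant one is rebuilt from 0 < n.
  nonzero zero    = >-nonZero (>-nonZero⁻¹ n)
  nonzero (suc i) = a≢0 (i mod p)

  positive : ∀ i → ℤ.Positive ([ + n ∷ [] ,overline map +_ a ] (suc i))
  positive i rewrite overline-map n a (suc i) =
    ℤ.positive (ℤ.+<+ (>-nonZero⁻¹ _ {{a≢0 (i mod p)}}))

  bound : ∀ i → (N ∷ᵖ Q) i ≤ N + sum Q
  bound zero    = m≤m+n N (sum Q)
  bound (suc i) = ≤-trans (lookup≤sum Q (i mod p)) (m≤n+m (sum Q) N)

  P-eq : ∀ i → (0 ∷ᵖ P) (suc i) + (0 ∷ᵖ P) i ≡ (n ∷ᵖ a) i * (N ∷ᵖ Q) (suc i)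
  P-eq zero rewrite P₁ | Q₀ = trans (+-identityʳ n) (sym (*-identityʳ n))
  P-eq (suc i) rewrite suc-mod i p {{p≢0}} = P-step (i mod p)

  Q-eq : ∀ i → (N ∷ᵖ Q) (2 + i) + (n ∷ᵖ a) i * (0 ∷ᵖ P) (suc i) ≡
               (N ∷ᵖ Q) i + (n ∷ᵖ a) i * (0 ∷ᵖ P) i
  Q-eq zero rewrite P₁ = trans Q₁ (sym (trans (cong (λ z → N + z) (*-zeroʳ n)) (+-identityʳ N)))
  Q-eq (suc i) rewrite suc-mod (suc i) p {{p≢0}} | suc-mod i p {{p≢0}} = Q-step (i mod p)

-- Minimality of the period.

overline-tail : ∀ {k p} .{{_ : NonZero p}} (pre : Vec ℤ k) (block : Vec ℤ p) i →
  [ pre ,overline block ] (k + i) ≡ lookup block (i mod p)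
overline-tail []        block i = refl
overline-tail (_ ∷ pre) block i = overline-tail pre block i

%≡%⇒∣ : ∀ i q p .{{_ : NonZero p}} → (i + q) % p ≡ i % p → p ∣ q
%≡%⇒∣ i q p eq = ∣m+n∣m⇒∣n {m = i / p * p} (divides ((i + q) / p) (+-cancelˡ-≡ (i % p) _ _ (begin
  i % p + (i / p * p + q)            ≡⟨ +-assoc (i % p) _ q ⟨
  i % p + i / p * p + q              ≡⟨ cong (_+ q) (m≡m%n+[m/n]*n i p) ⟨
  i + q                              ≡⟨ m≡m%n+[m/n]*n (i + q) p ⟩
  (i + q) % p + (i + q) / p * p      ≡⟨ cong (_+ (i + q) / p * p) eq ⟩
  i % p + (i + q) / p * p            ∎))) (divides (i / p) refl)
  where open ≡-Reasoning

-- A competing block may come with a longer preperiod, so the unique entry is observed beyond both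
-- preperiods. There a shift by `q` preserves its value, hence its residue modulo `p`, and `p`
-- divides `q`.
unique-entry⇒IsPeriodLength : ∀ {k p} .{{p≢0 : NonZero p}} (pre : Vec ℤ (suc k)) (block : Vec ℤ p) ℓ →
  (∀ i → lookup block i ≡ lookup block ℓ → i ≡ ℓ) → IsPeriodLength [ pre ,overline block ] p
unique-entry⇒IsPeriodLength {k} {p@(suc p-1)} pre block ℓ unique =
  (_ , k , pre , block , λ _ → refl) , minimal
  where
  minimal : ∀ q → HasRepeatingBlock [ pre ,overline block ] q → p ≤ q
  minimal q (q≢0 , k′ , pre′ , block′ , same) = ∣⇒≤ {{q≢0}} (%≡%⇒∣ i q p (begin
    (i + q) % p         ≡⟨ toℕ-mod (i + q) p ⟨
    toℕ ((i + q) mod p) ≡⟨ cong toℕ (unique ((i + q) mod p) (trans shifted (cong (lookup block) i≡ℓ))) ⟩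
    toℕ ℓ               ≡⟨ cong toℕ i≡ℓ ⟨
    toℕ (i mod p)       ≡⟨ toℕ-mod i p ⟩
    i % p               ∎))
    where
    open ≡-Reasoning
    instance _ = q≢0

    i i′ : ℕ
    -- Adding `suc k′` whole periods keeps the residue `ℓ` and passes `pre′`. The same place is `i`
    -- counted after `pre` and `i′` counted after `pre′`.
    i  = toℕ ℓ + suc k′ * p
    i′ = suc k + toℕ ℓ + suc k′ * p-1

    i≡ℓ : i mod p ≡ ℓ
    i≡ℓ = toℕ-injective (trans (toℕ-mod i p)
      (trans ([m+kn]%n≡m%n (toℕ ℓ) (suc k′) p) (m<n⇒m%n≡m (toℕ<n ℓ))))

    reindex : suc k + i ≡ suc k′ + i′
    reindex = lemma (suc k) (toℕ ℓ) (suc k′) p-1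
      where
      lemma : ∀ k l m p → k + (l + m * suc p) ≡ m + (k + l + m * p)
      lemma = solve-∀

    shifted : lookup block ((i + q) mod p) ≡ lookup block (i mod p)
    shifted = begin
      lookup block ((i + q) mod p)                       ≡⟨ overline-tail pre block (i + q) ⟨
      [ pre ,overline block ] (suc k + (i + q))          ≡⟨ same (suc k + (i + q)) ⟩
      [ pre′ ,overline block′ ] (suc k + (i + q))
        ≡⟨ cong [ pre′ ,overline block′ ]
             (trans (sym (+-assoc (suc k) i q)) (trans (cong (_+ q) reindex) (+-assoc (suc k′) i′ q))) ⟩
      [ pre′ ,overline block′ ] (suc k′ + (i′ + q))      ≡⟨ overline-tail pre′ block′ (i′ + q) ⟩
      lookup block′ ((i′ + q) mod q)                     ≡⟨ cong (lookup block′) (mod-cong q ([m+n]%n≡m%n i′ q)) ⟩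
      lookup block′ (i′ mod q)                           ≡⟨ overline-tail pre′ block′ i′ ⟨
      [ pre′ ,overline block′ ] (suc k′ + i′)            ≡⟨ cong [ pre′ ,overline block′ ] reindex ⟨
      [ pre′ ,overline block′ ] (suc k + i)              ≡⟨ same (suc k + i) ⟨
      [ pre ,overline block ] (suc k + i)                ≡⟨ overline-tail pre block i ⟩
      lookup block (i mod p)                             ∎

-- The two families of expansions.

-- Parametrising by `m` makes `suc m` = (n - 3) / 2 visibly positive and each recurrence a
-- polynomial identity.
odd-case : ∀ m → let n = 5 + m * 2 ; block = + 1 ∷ + suc m ∷ + 1 ∷ + (2 * n) ∷ [] in
  IsContinuedFractionOf [ + n ∷ [] ,overline block ] (√ (n ^ 2 + (2 * n ∸ 3))) ×
  IsPeriodLength [ + n ∷ [] ,overline block ] 4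
odd-case m =
  periodic-√ (n ^ 2 + (2 * n ∸ 3)) n (1 ∷ suc m ∷ 1 ∷ 2 * n ∷ [])
    -- In terms of n, P is n, n - 3, n - 3, n and Q is 1, 2n - 3, 4, 2n - 3.
    (n ∷ 2 + m * 2 ∷ 2 + m * 2 ∷ n ∷ [])
    (1 ∷ 7 + m * 4 ∷ 4 ∷ 7 + m * 4 ∷ [])
    (λ { 0F → _ ; 1F → _ ; 2F → _ ; 3F → _ })
    refl refl (Q₁ m)
    (λ { 0F → P₂ m ; 1F → P₃ m ; 2F → P₄ m ; 3F → P₅ m })
    (λ { 0F → refl ; 1F → refl ; 2F → refl ; 3F → refl }) ,
  unique-entry⇒IsPeriodLength (+ n ∷ []) (+ 1 ∷ + suc m ∷ + 1 ∷ + (2 * n) ∷ []) 3F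
    (λ { 0F () ; 1F eq → contradiction (trans (suc-injective (ℤ.+-injective eq)) (2n m)) (m≢1+m+n m)
       ; 2F () ; 3F _ → refl })
  where
  n : ℕ
  n = 5 + m * 2
  -- 2 * n ∸ 3 and 2 * n are written in reduced form, for the ring solver's sake.
  2n : ∀ m → 4 + m * 2 + (5 + m * 2 + 0) ≡ suc (m + (8 + m * 3))
  2n = solve-∀
  Q₁ : ∀ m → 7 + m * 4 + (5 + m * 2) * (5 + m * 2) ≡
             (5 + m * 2) * ((5 + m * 2) * 1) + (2 + m * 2 + (5 + m * 2 + 0))
  Q₁ = solve-∀
  P₂ : ∀ m → 2 + m * 2 + (5 + m * 2) ≡ 1 * (7 + m * 4)
  P₂ = solve-∀
  P₃ : ∀ m → 2 + m * 2 + (2 + m * 2) ≡ suc m * 4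
  P₃ = solve-∀
  P₄ : ∀ m → 5 + m * 2 + (2 + m * 2) ≡ 1 * (7 + m * 4)
  P₄ = solve-∀
  P₅ : ∀ m → 5 + m * 2 + (5 + m * 2) ≡ 2 * (5 + m * 2) * 1
  P₅ = solve-∀

even-case : ∀ m → let n = 4 + m * 2
                      block = + 1 ∷ + suc m ∷ + 2 ∷ + suc m ∷ + 1 ∷ + (2 * n) ∷ [] in
  IsContinuedFractionOf [ + n ∷ [] ,overline block ] (√ (n ^ 2 + (2 * n ∸ 3))) ×
  IsPeriodLength [ + n ∷ [] ,overline block ] 6
even-case m =
  periodic-√ (n ^ 2 + (2 * n ∸ 3)) n (1 ∷ suc m ∷ 2 ∷ suc m ∷ 1 ∷ 2 * n ∷ [])
    -- In terms of n, P is n, n - 3, n - 1, n - 1, n - 3, n and Q is 1, 2n - 3, 4, n - 1, 4, 2n - 3.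
    (n ∷ 1 + m * 2 ∷ 3 + m * 2 ∷ 3 + m * 2 ∷ 1 + m * 2 ∷ n ∷ [])
    (1 ∷ 5 + m * 4 ∷ 4 ∷ 3 + m * 2 ∷ 4 ∷ 5 + m * 4 ∷ [])
    (λ { 0F → _ ; 1F → _ ; 2F → _ ; 3F → _ ; 4F → _ ; 5F → _ })
    refl refl (Q₁ m)
    (λ { 0F → P₂ m ; 1F → P₃ m ; 2F → P₄ m ; 3F → P₅ m ; 4F → P₆ m ; 5F → P₇ m })
    -- Apart from its last entry the block is a palindrome, so the check at `3F` is the one at `1F`
    -- reversed.
    (λ { 0F → refl ; 1F → Q₃ m ; 2F → refl ; 3F → sym (Q₃ m) ; 4F → refl ; 5F → refl }) ,
  unique-entry⇒IsPeriodLength (+ n ∷ []) (+ 1 ∷ + suc m ∷ + 2 ∷ + suc m ∷ + 1 ∷ + (2 * n) ∷ []) 5F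
    (λ { 0F () ; 1F eq → contradiction eq suc-m≢2n ; 2F () ; 3F eq → contradiction eq suc-m≢2n
       ; 4F () ; 5F _ → refl })
  where
  n : ℕ
  n = 4 + m * 2
  2n : ∀ m → 3 + m * 2 + (4 + m * 2 + 0) ≡ suc (m + (6 + m * 3))
  2n = solve-∀
  suc-m≢2n : + suc m ≢ + (2 * n)
  suc-m≢2n eq = m≢1+m+n m (trans (suc-injective (ℤ.+-injective eq)) (2n m))
  Q₁ : ∀ m → 5 + m * 4 + (4 + m * 2) * (4 + m * 2) ≡
             (4 + m * 2) * ((4 + m * 2) * 1) + (1 + m * 2 + (4 + m * 2 + 0))
  Q₁ = solve-∀
  P₂ : ∀ m → 1 + m * 2 + (4 + m * 2) ≡ 1 * (5 + m * 4)
  P₂ = solve-∀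
  P₃ : ∀ m → 3 + m * 2 + (1 + m * 2) ≡ suc m * 4
  P₃ = solve-∀
  P₄ : ∀ m → 3 + m * 2 + (3 + m * 2) ≡ 2 * (3 + m * 2)
  P₄ = solve-∀
  P₅ : ∀ m → 1 + m * 2 + (3 + m * 2) ≡ suc m * 4
  P₅ = solve-∀
  P₆ : ∀ m → 4 + m * 2 + (1 + m * 2) ≡ 1 * (5 + m * 4)
  P₆ = solve-∀
  P₇ : ∀ m → 4 + m * 2 + (4 + m * 2) ≡ 2 * (4 + m * 2) * 1
  P₇ = solve-∀
  Q₃ : ∀ m → 3 + m * 2 + suc m * (3 + m * 2) ≡ 5 + m * 4 + suc m * (1 + m * 2)
  Q₃ = solve-∀

-- Parity cases and the conclusion.

-- The bound excludes 1 and 3; at 3 the entry (n - 3) / 2 would be 0.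
odd≡5+2* : ∀ {n} → 3 < n → 2 ∤ n → ∃[ m ] n ≡ 5 + m * 2
odd≡5+2* {n} 3<n 2∤n
  with n / 2 | n % 2 | m≡m%n+[m/n]*n n 2 | m%n<n n 2 | m%n≡0⇒n∣m n 2
... | _           | 0             | _    | _                | 2∣n = contradiction (2∣n refl) 2∤n
... | suc (suc m) | 1             | eq   | _                | _   = m , eq
... | 0           | 1             | refl | _                | _   = contradiction 3<n (λ { (s≤s ()) })
... | 1           | 1             | refl | _                | _   = contradiction 3<n (λ { (s≤s (s≤s (s≤s ()))) })
... | _           | suc (suc _)   | _    | s≤s (s≤s ())     | _

even≡4+2* : ∀ {n} → 3 < n → 2 ∣ n → ∃[ m ] n ≡ 4 + m * 2
even≡4+2* _                   (divides (suc (suc m)) eq) = m , eq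
even≡4+2* ()                  (divides 0 refl)
even≡4+2* (s≤s (s≤s ()))      (divides 1 refl)

mainTheorem5 : (n : ℕ) → 3 < n →
    let j = 2 * n ∸ 3
        N = n ^ 2 + j
        odd-expansion = [ + n ∷ [] ,overline + 1 ∷ + ((n ∸ 3) / 2) ∷ + 1 ∷ + (2 * n) ∷ [] ]
        even-expansion = [ + n ∷ [] ,overline + 1 ∷ + (n / 2 ∸ 1) ∷ + 2 ∷ + (n / 2 ∸ 1) ∷ + 1 ∷ + (2 * n) ∷ [] ]
    in (2 ∤ n → IsContinuedFractionOf odd-expansion (√ N) × IsPeriodLength odd-expansion 4)
     × (2 ∣ n → IsContinuedFractionOf even-expansion (√ N) × IsPeriodLength even-expansion 6)
mainTheorem5 n 3<n = odd , even
  where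
  odd : 2 ∤ n → let e = [ + n ∷ [] ,overline + 1 ∷ + ((n ∸ 3) / 2) ∷ + 1 ∷ + (2 * n) ∷ [] ] in
    IsContinuedFractionOf e (√ (n ^ 2 + (2 * n ∸ 3))) × IsPeriodLength e 4
  -- Now `n ∸ 3` computes to `suc m * 2`, so only the division is left to rewrite.
  odd 2∤n with m , refl ← odd≡5+2* 3<n 2∤n = subst
    (λ a → let e = [ + n ∷ [] ,overline + 1 ∷ + a ∷ + 1 ∷ + (2 * n) ∷ [] ] in
      IsContinuedFractionOf e (√ (n ^ 2 + (2 * n ∸ 3))) × IsPeriodLength e 4)
    (sym (m*n/n≡m (suc m) 2)) (odd-case m)

  even : 2 ∣ n → let e = [ + n ∷ [] ,overline + 1 ∷ + (n / 2 ∸ 1) ∷ + 2 ∷ + (n / 2 ∸ 1) ∷ + 1 ∷ + (2 * n) ∷ [] ] in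
    IsContinuedFractionOf e (√ (n ^ 2 + (2 * n ∸ 3))) × IsPeriodLength e 6
  -- Here `n` computes to `(2 + m) * 2`, and `(2 + m) ∸ 1` to the entry `suc m`.
  even 2∣n with m , refl ← even≡4+2* 3<n 2∣n = subst
    (λ h → let e = [ + n ∷ [] ,overline + 1 ∷ + (h ∸ 1) ∷ + 2 ∷ + (h ∸ 1) ∷ + 1 ∷ + (2 * n) ∷ [] ] in
      IsContinuedFractionOf e (√ (n ^ 2 + (2 * n ∸ 3))) × IsPeriodLength e 6)
    (sym (m*n/n≡m (2 + m) 2)) (even-case m)
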